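{- Every class of finite graphs with bounded Baker-treewidth has asymptotic dimension at most $2$.
   Context: A layering of $G$ is an ordered partition $(L_0,L_1,\dots)$ of $V(G)$ such that every edge has its ends in the same or consecutive parts. A class $\mathcal{G}$ has bounded Baker-treewidth if there is $f\colon\mathbb{N}\to\mathbb{N}$ such that every $G\in\mathcal{G}$ has a layering in which the subgraph induced by the union of any $\ell$ consecutive layers has treewidth at most $f(\ell)$. With $\mathrm{dist}_G$ the shortest-path metric: the weak-diameter of $X\subseteq V(G)$ is $\max\{\mathrm{dist}_G(u,v)\colon u,v\in X\}$; a collection $\mathcal{U}$ of vertex sets is $\delta$-disjoint if $\mathrm{dist}_G(X,Y)>\delta$ for all distinct $X,Y\in\mathcal{U}$, and $(k,\delta)$-disjoint if it is a union of $k$ $\delta$-disjoint subcollections. $f\colon\mathbb{R}^+\to\mathbb{R}^+$ is a $d$-dimensional control function for $G$ if for every $\delta\ge 0$ there is a $(d+1,\delta)$-disjoint partition of $V(G)$ into sets of weak-diameter at most $f(\delta)$. The asymptotic dimension of a class is the minimum $d$ for which a single $d$-dimensional control function works for all graphs in the class (infinite if none exists). -}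

module Defs where

open import Data.Nat using (ℕ; zero; suc; _+_; _≤_; _<_)
open import Data.Fin using (Fin)
open import Data.Fin.Subset using (Subset; _∈_; ∣_∣)
open import Data.Bool using (Bool; true; false)
open import Data.List using (List; []; _∷_; _++_; length)
open import Data.List.Relation.Unary.Unique.Propositional using (Unique)
open import Data.List.Relation.Unary.Linked using (Linked)
open import Data.Product using (Σ; ∃; _×_; _,_)
open import Relation.Nullary using (¬_)
open import Data.Unit using (⊤)
open import Relation.Binary.PropositionalEquality using (_≡_; _≢_)

record Graph : Set where
  field
    n      : ℕ
    adj    : Fin n → Fin n → Bool
    sym    : ∀ u v → adj u v ≡ adj v u
    irrefl : ∀ u → adj u u ≡ false

open Graph public

V : Graph → Set
V G = Fin (n G)

Edge : (G : Graph) → V G → V G → Set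
Edge G u v = adj G u v ≡ true

data Walk (G : Graph) : V G → V G → ℕ → Set where
  here : ∀ {u} → Walk G u u 0
  step : ∀ {u w v l} → Edge G u w → Walk G w v l → Walk G u v (suc l)

-- dist_G(u,v) ≤ k  (false if u,v lie in different components, i.e. dist = ∞)
DistLe : (G : Graph) → V G → V G → ℕ → Set
DistLe G u v k = ∃ λ l → l ≤ k × Walk G u v l

data WalkWithin (G : Graph) (P : V G → Set) : V G → V G → Set where
  here : ∀ {u} → P u → WalkWithin G P u u
  step : ∀ {u w v} → P u → Edge G u w → WalkWithin G P w v → WalkWithin G P u v

Connected : Graph → Set
Connected G = ∀ s t → WalkWithin G (λ _ → ⊤) s t

Cycle : Graph → Set
Cycle G = Σ (V G) λ x → Σ (List (V G)) λ xs →
  (3 ≤ length (x ∷ xs)) × Unique (x ∷ xs) × Linked (Edge G) (x ∷ xs ++ x ∷ [])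

IsTree : Graph → Set
IsTree T = (0 < n T) × Connected T × ¬ Cycle T

record TreeDecomposition (G : Graph) (S : V G → Set) (k : ℕ) : Set where
  field
    tree       : Graph
    isTree     : IsTree tree
    bag        : V tree → Subset (n G)
    bag⊆S      : ∀ t v → v ∈ bag t → S v
    vertexCov  : ∀ v → S v → ∃ λ t → v ∈ bag t
    edgeCov    : ∀ u v → S u → S v → Edge G u v → ∃ λ t → u ∈ bag t × v ∈ bag t
    subtree    : ∀ v s t → v ∈ bag s → v ∈ bag t →
                   WalkWithin tree (λ r → v ∈ bag r) s t
    width      : ∀ t → ∣ bag t ∣ ≤ suc k

TreewidthLe : (G : Graph) → (V G → Set) → ℕ → Set
TreewidthLe G S k = TreeDecomposition G S k

-- a layering given by the layer index of each vertex: v ∈ L_(layer v)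
IsLayering : (G : Graph) → (V G → ℕ) → Set
IsLayering G layer = ∀ u v → Edge G u v → layer u ≤ suc (layer v) × layer v ≤ suc (layer u)

GraphClass : Set₁
GraphClass = Graph → Set

BoundedBakerTreewidth : GraphClass → Set
BoundedBakerTreewidth 𝒢 = Σ (ℕ → ℕ) λ f → ∀ G → 𝒢 G →
  Σ (V G → ℕ) λ layer → IsLayering G layer ×
    (∀ ℓ i → TreewidthLe G (λ v → i ≤ layer v × layer v < i + ℓ) (f ℓ))

-- A (d+1,δ)-disjoint partition of V(G) into sets of weak-diameter ≤ D:
-- part v is the index of the part containing v, col p ∈ Fin (d+1) is the
-- δ-disjoint subcollection that part p belongs to.
record ControlledPartition (G : Graph) (d δ D : ℕ) : Set where
  field
    part     : V G → ℕ
    col      : ℕ → Fin (suc d)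
    weakDiam : ∀ u v → part u ≡ part v → DistLe G u v D
    disjoint : ∀ u v → part u ≢ part v → col (part u) ≡ col (part v) →
                 ¬ DistLe G u v δ

IsControlFunction : ℕ → (ℕ → ℕ) → Graph → Set
IsControlFunction d f G = ∀ δ → ControlledPartition G d δ (f δ)

AsdimLe : GraphClass → ℕ → Set
AsdimLe 𝒢 k = Σ ℕ λ d → d ≤ k × Σ (ℕ → ℕ) λ f → ∀ G → 𝒢 G → IsControlFunction d f G

{-# OPTIONS --safe #-}
-- Call a δ-chain a sequence of vertices with consecutive distances at most δ. It suffices to
-- 3-colour the vertices so that monochromatic δ-chains have bounded end-to-end distance: the parts
-- are then the chain components of the colour classes.
--
-- Bounded treewidth, two colours, by induction on the bag size. Cut the rooted decomposition tree
-- into pieces: a node leaves the piece of its parent when its bag is far from the centre of that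
-- piece (the bag of the root of the piece together with the bag above it). Around the bag above a
-- piece, vertices at distance at most ρ are moved to the parent piece, those at distance in
-- (ρ, 2ρ] form a ring of the first colour, and the other vertices near the centre get the second
-- colour. In the rest every bag loses its vertices near the centre, so the rest is coloured by
-- induction, at a scale exceeding the diameter of the rings. Chains of the second colour cannot
-- cross a ring, and a chain of the first colour that uses a ring only joins vertices which the
-- larger scale already puts in one component.
--
-- Layerings: cut the layers into slabs of thickness δ + 1 and colour slab i with the two colours
-- different from i mod 3. A short path between vertices of a slab stays in a slightly wider slab,
-- which has bounded treewidth. A colour lives in pairs of consecutive slabs; colouring odd slabs at
-- a scale exceeding the diameter of the components in even slabs keeps the union of a pair bounded.
module Submission where

open import Defs
open import Data.Bool using (Bool; true; false; not; _∧_)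
import Data.Bool.Properties as Bool
open import Data.Empty using (⊥; ⊥-elim)
open import Data.Fin using (Fin; zero; suc; toℕ; fromℕ<)
import Data.Fin.Properties as Fin
open import Data.Fin.Subset as Subset using (Subset; inside; outside; ∣_∣)
open import Data.List using (List; []; _∷_; _++_; length; map; filter; allFin; cartesianProduct)
import Data.List.Properties as List
open import Data.List.Membership.Propositional using (_∈_; find; lose)
open import Data.List.Membership.Propositional.Properties using (∈-map⁺; ∈-map⁻; ∈-filter⁺; ∈-filter⁻; ∈-allFin; ∈-cartesianProduct⁺)
open import Data.List.Relation.Unary.All as All using (All; []; _∷_)
open import Data.List.Relation.Unary.All.Properties using (¬Any⇒All¬)
open import Data.List.Relation.Unary.AllPairs using ([]; _∷_)
open import Data.List.Relation.Unary.Any as Any using (Any; here; there)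
import Data.List.Relation.Unary.Any.Properties as Any
open import Data.List.Relation.Unary.Linked using (Linked; [-]; _∷_)
open import Data.List.Relation.Unary.Unique.Propositional using (Unique)
open import Data.Maybe using (Maybe; just; nothing; maybe)
open import Data.Maybe.Properties using (just-injective)
open import Data.Nat
open import Data.Nat.DivMod using (m/n*n≤m; m%n<n; m≡m%n+[m/n]*n; m<n*o⇒m/o<n)
open import Data.Nat.Properties
open import Data.Nat.Tactic.RingSolver using (solve-∀)
open import Data.Product using (Σ; ∃; _×_; _,_; proj₁; proj₂)
open import Data.Sum as Sum using (_⊎_; inj₁; inj₂)
open import Data.Vec using ([]; _∷_; here; there)
open import Function using (_∘_)
open import Relation.Binary.Construct.Closure.Equivalence as Eq using (EqClosure)
open import Relation.Binary.Construct.Closure.ReflexiveTransitive using (ε; _◅_)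
open import Relation.Binary.Construct.Closure.Symmetric using (fwd; bwd)
open import Relation.Binary.Definitions using (tri<; tri≈; tri>)
open import Relation.Binary.PropositionalEquality as ≡ using (_≡_; _≢_; refl; cong; subst)
open import Relation.Nullary using (¬_; Dec; yes; no; does; contradiction)
open import Relation.Nullary.Decidable as Dec using (_×-dec_; ¬?)

-- Distances, chains and unions of balls.

ballBound : ℕ → ℕ → ℕ → ℕ
ballBound zero    δ r = 0
ballBound (suc k) δ r = 2 * r + 2 * (ballBound k δ r + δ)

module Metric (G : Graph) where

  walk? : ∀ u v l → Dec (Walk G u v l)
  walk? u v zero    = Dec.map′ (λ { refl → here }) (λ { here → refl }) (u Fin.≟ v)
  walk? u v (suc l) =
    Dec.map′ (λ { (w , e , p) → step e p }) (λ { (step e p) → _ , e , p })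
      (Fin.any? λ w → (adj G u w Bool.≟ true) ×-dec walk? w v l)

  dist? : ∀ u v k → Dec (DistLe G u v k)
  dist? u v k = Dec.map′ (λ { (l , l<1+k , p) → l , s≤s⁻¹ l<1+k , p })
                         (λ { (l , l≤k , p) → l , s≤s l≤k , p })
                         (anyUpTo? (walk? u v) (suc k))

  walk-++ : ∀ {u v w k l} → Walk G u v k → Walk G v w l → Walk G u w (k + l)
  walk-++ here       q = q
  walk-++ (step e p) q = step e (walk-++ p q)

  walk-reverse : ∀ {u v l} → Walk G u v l → Walk G v u l
  walk-reverse here = here
  walk-reverse {u} {l = suc l} (step {w = w} e p) =
    subst (Walk G _ _) (+-comm l 1)
      (walk-++ (walk-reverse p) (step (≡.trans (sym G w u) e) here))

  dist-refl : ∀ {u k} → DistLe G u u k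
  dist-refl = 0 , z≤n , here

  dist-sym : ∀ {u v k} → DistLe G u v k → DistLe G v u k
  dist-sym (l , l≤k , p) = l , l≤k , walk-reverse p

  dist-trans : ∀ {u v w k l} → DistLe G u v k → DistLe G v w l → DistLe G u w (k + l)
  dist-trans (_ , i≤k , p) (_ , j≤l , q) = _ , +-mono-≤ i≤k j≤l , walk-++ p q

  dist-mono : ∀ {u v k l} → k ≤ l → DistLe G u v k → DistLe G u v l
  dist-mono k≤l (i , i≤k , p) = i , ≤-trans i≤k k≤l , p

  Near : ℕ → List (V G) → V G → Set
  Near r xs v = Any (λ x → DistLe G v x r) xs

  near? : ∀ r xs v → Dec (Near r xs v)
  near? r xs v = Any.any? (λ x → dist? v x r) xs

  near-mono : ∀ {r r′ xs v} → r ≤ r′ → Near r xs v → Near r′ xs v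
  near-mono r≤r′ = Any.map (dist-mono r≤r′)

  near-trans : ∀ {u v k r xs} → DistLe G u v k → Near r xs v → Near (k + r) xs u
  near-trans d = Any.map (dist-trans d)

  data Chain (δ : ℕ) (P : V G → Set) : V G → V G → Set where
    [_]  : ∀ {u} → P u → Chain δ P u u
    cons : ∀ {u w v} → P u → DistLe G u w δ → Chain δ P w v → Chain δ P u v

  chain-map : ∀ {δ δ′ P Q u v} → δ ≤ δ′ → (∀ {w} → P w → Q w) → Chain δ P u v → Chain δ′ Q u v
  chain-map le f [ p ]        = [ f p ]
  chain-map le f (cons p d c) = cons (f p) (dist-mono le d) (chain-map le f c)

  chain-head : ∀ {δ P u v} → Chain δ P u v → P u
  chain-head [ p ]        = p
  chain-head (cons p _ _) = p

  chain-last : ∀ {δ P u v} → Chain δ P u v → P v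
  chain-last [ p ]        = p
  chain-last (cons _ _ c) = chain-last c

  -- Used to confine a chain to one piece of the forest or to one block of slabs.
  chain-invariant : ∀ {δ P u v} {A : Set} (f : V G → A) →
    (∀ {x y} → P x → P y → DistLe G x y δ → f x ≡ f y) →
    Chain δ P u v → Chain δ (λ w → P w × f w ≡ f u) u v
  chain-invariant f inv [ p ] = [ p , refl ]
  chain-invariant {δ} {P} {u} f inv (cons p d c) =
    cons (p , refl) d
      (chain-map ≤-refl (λ { (pw , eq) → pw , ≡.trans eq (≡.sym (inv p (chain-head c) d)) })
        (chain-invariant f inv c))

  Bounded : ℕ → (V G → Set) → ℕ → Set
  Bounded δ P D = ∀ {u v} → Chain δ P u v → DistLe G u v D

  -- Replacing each run of Q-vertices by a single jump turns a δ-chain into an (A + 2δ)-chain in P.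
  module _ {δ A D : ℕ} {P Q R : V G → Set} (split : ∀ {w} → R w → P w ⊎ Q w)
           (boundQ : Bounded δ Q A) (boundP : Bounded (A + 2 * δ) P D) where

    private
      -- The possibly empty `Q`-run before the first `P`-vertex `p`, together with the step into
      -- `p`.
      Prefix : V G → V G → Set
      Prefix u p = u ≡ p ⊎ ∃ λ w → Chain δ Q u w × DistLe G w p δ

      prefix-dist : ∀ {u p} → Prefix u p → DistLe G u p (A + δ)
      prefix-dist (inj₁ refl)        = dist-refl
      prefix-dist (inj₂ (w , c , d)) = dist-trans (boundQ c) d

      Summary : V G → V G → Set
      Summary u v = Chain δ Q u v ⊎
        ∃ λ p → ∃ λ p′ → Prefix u p × Chain (A + 2 * δ) P p p′ × DistLe G p′ v (A + δ)

      summary : ∀ {u v} → Chain δ R u v → Summary u v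
      summary [ r ] with split r
      ... | inj₁ p = inj₂ (_ , _ , inj₁ refl , [ p ] , dist-refl)
      ... | inj₂ q = inj₁ [ q ]
      summary (cons r d c) with split r | summary c
      ... | inj₁ p | inj₁ qs =
        inj₂ (_ , _ , inj₁ refl , [ p ] , dist-mono (≤-reflexive (+-comm δ A)) (dist-trans d (boundQ qs)))
      -- A jump consists of a step into a `Q`-run, the run itself and a step out of it, whence A +
      -- 2δ.
      ... | inj₁ p | inj₂ (_ , _ , pre , ps , e) =
        inj₂ (_ , _ , inj₁ refl , cons p (dist-mono (≤-reflexive (eq δ A)) (dist-trans d (prefix-dist pre))) ps , e)
        where
        eq : ∀ δ A → δ + (A + δ) ≡ A + 2 * δ
        eq = solve-∀
      ... | inj₂ q | inj₁ qs = inj₁ (cons q d qs)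
      ... | inj₂ q | inj₂ (_ , _ , inj₁ refl , ps , e) = inj₂ (_ , _ , inj₂ (_ , [ q ] , d) , ps , e)
      ... | inj₂ q | inj₂ (_ , _ , inj₂ (_ , qs , d′) , ps , e) =
        inj₂ (_ , _ , inj₂ (_ , cons q d qs , d′) , ps , e)

    absorb : Bounded δ R (D + 2 * (A + δ))
    absorb c with summary c
    ... | inj₁ qs = dist-mono (≤-trans (m≤m+n A (δ + (A + δ))) (≤-trans (≤-reflexive (eq A δ)) (m≤n+m _ D))) (boundQ qs)
      where
      eq : ∀ A δ → A + (δ + (A + δ)) ≡ 2 * (A + δ)
      eq = solve-∀
    ... | inj₂ (_ , _ , pre , ps , e) =
      dist-mono (≤-reflexive (eq A δ D)) (dist-trans (prefix-dist pre) (dist-trans (boundP ps) e))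
      where
      eq : ∀ A δ D → A + δ + (D + (A + δ)) ≡ D + 2 * (A + δ)
      eq = solve-∀

  -- Runs in the remaining balls are absorbed into the ball around `x`, which is bounded at every
  -- scale because any two of its vertices are within 2r.
  balls-bounded : ∀ k {δ r} xs → length xs ≤ k → Bounded δ (Near r xs) (ballBound k δ r)
  balls-bounded k       []       _         c with () ← chain-head c
  balls-bounded (suc k) {δ} {r} (x ∷ xs) (s≤s len) =
    absorb {P = λ w → DistLe G w x r} (λ { (here d) → inj₁ d ; (there n) → inj₂ n })
      (balls-bounded k xs len) single
    where
    single : ∀ {ε} → Bounded ε (λ w → DistLe G w x r) (2 * r)
    single c = dist-mono (≤-reflexive (cong (r +_) (≡.sym (+-identityʳ r))))
                 (dist-trans (chain-head c) (dist-sym (chain-last c)))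

-- Rooted forests and the ancestor order.

record Forest (m : ℕ) : Set where
  field
    par  : Fin m → Maybe (Fin m)
    dep  : Fin m → ℕ
    par< : ∀ {t p} → par t ≡ just p → dep p < dep t

  par-unique : ∀ {t p p′} → par t ≡ just p → par t ≡ just p′ → p ≡ p′
  par-unique e e′ = just-injective (≡.trans (≡.sym e) e′)

  infix 4 _⊑_
  data _⊑_ (s : Fin m) : Fin m → Set where
    self : s ⊑ s
    up   : ∀ {t p} → par t ≡ just p → s ⊑ p → s ⊑ t

  ⊑-trans : ∀ {r s t} → r ⊑ s → s ⊑ t → r ⊑ t
  ⊑-trans rs self      = rs
  ⊑-trans rs (up e st) = up e (⊑-trans rs st)

  ⊑-dep : ∀ {s t} → s ⊑ t → s ≡ t ⊎ dep s < dep t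
  ⊑-dep self = inj₁ refl
  ⊑-dep (up e st) with ⊑-dep st
  ... | inj₁ refl = inj₂ (par< e)
  ... | inj₂ lt   = inj₂ (<-trans lt (par< e))

  ⊑-shallow : ∀ {s t} → s ⊑ t → dep t ≤ dep s → s ≡ t
  ⊑-shallow st le with ⊑-dep st
  ... | inj₁ eq = eq
  ... | inj₂ lt = contradiction le (<⇒≱ lt)

  par⋢ : ∀ {s p} → par s ≡ just p → ¬ s ⊑ p
  par⋢ e sp with ⊑-dep sp
  ... | inj₁ refl = <-irrefl refl (par< e)
  ... | inj₂ lt   = <-asym lt (par< e)

-- Coarse decompositions and the constants of the induction.

reach : ℕ → ℕ → ℕ → ℕ
reach zero    δ c = 0
reach (suc k) δ c =
  let ρ = δ + c in
  -- One summand serves the smaller decomposition, the other `moved-far`, which follows paths of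
  -- length 2ρ.
  reach k (ballBound (suc k) δ (2 * ρ) + 2 * δ) ρ + 2 * ρ

-- The outer summands are the bounds for the colours `true` and `false`; their sum stands in for the
-- maximum.
diameter : ℕ → ℕ → ℕ → ℕ
diameter zero    δ c = 0
diameter (suc k) δ c =
  let ρ  = δ + c
      A  = ballBound (suc k) δ (2 * ρ)
      Δ  = A + 2 * δ
      D′ = diameter k Δ ρ
      R  = reach k Δ ρ + ρ + (4 * ρ + c)
  in (D′ + 2 * (A + δ)) + (ballBound (suc k + suc k) (D′ + 2 * δ) R + 2 * (D′ + δ))

module _ (G : Graph) where
  open Metric G

  -- A tree-decomposition of X up to an error c: a vertex only has to be close to the bag of its
  -- home, and a bag only has to come close to the paths of length at most M that it separates.
  record CoarseDecomposition (m k c M : ℕ) : Set₁ where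
    field
      forest : Forest m
    open Forest forest public
    field
      bag      : Fin m → List (V G)
      bag-size : ∀ t → length (bag t) ≤ k
      -- The vertices still to be coloured. Distances remain those of `G`, so paths may use other
      -- vertices.
      X        : V G → Set
      home     : V G → Fin m
      near-home : ∀ {v} → X v → Near c (bag (home v)) v
      separates : ∀ {u v s r} → X u → X v → s ⊑ home v → ¬ s ⊑ home u → r ≤ M → DistLe G u v r →
                  ∃ λ p → par s ≡ just p × Near (r + c) (bag p) v
      separates-bag : ∀ {v s p t r} → X v → s ⊑ home v → par s ≡ just p → t ⊑ p → r ≤ M →
                      Near r (bag t) v → Near (r + c) (bag s) v

  -- The induction step: pieces, rings and cores.

  module Step {m k : ℕ} (δ c : ℕ) (O : CoarseDecomposition m (suc k) c (reach (suc k) δ c)) where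
    open CoarseDecomposition O

    ρ A Δ D′ M′ near far : ℕ
    ρ  = δ + c
    -- `A` bounds chains in a ring, and `Δ` is the scale of the chain left when `absorb` skips such
    -- runs.
    A  = ballBound (suc k) δ (2 * ρ)
    Δ  = A + 2 * δ
    D′ = diameter k Δ ρ
    M′ = reach k Δ ρ
    -- In `moved-far`: 2ρ + c from a bag to the vertex, then 2ρ on to the centre.
    near = 4 * ρ + c
    -- In `keep`: at most M′ + ρ from a vertex to a bag, then `near` on to the centre.
    far  = M′ + ρ + near

    parentBag : Fin m → List (V G)
    parentBag s = maybe bag [] (par s)

    parentBag-size : ∀ s → length (parentBag s) ≤ suc k
    parentBag-size s with par s
    ... | just p  = bag-size p
    ... | nothing = z≤n

    centre : Fin m → List (V G)
    centre s = parentBag s ++ bag s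

    centre-size : ∀ s → length (centre s) ≤ suc k + suc k
    centre-size s rewrite List.length-++ (parentBag s) {bag s} = +-mono-≤ (parentBag-size s) (bag-size s)

    parentBag-just : ∀ {s p} → par s ≡ just p → parentBag s ≡ bag p
    parentBag-just e = cong (maybe bag []) e

    near-parent⇒centre : ∀ {r s p v} → par s ≡ just p → Near r (bag p) v → Near r (centre s) v
    near-parent⇒centre e nr = Any.++⁺ˡ (subst (λ b → Near _ b _) (≡.sym (parentBag-just e)) nr)

    Touches : Fin m → Fin m → Set
    Touches t s = Any (Near near (centre s)) (bag t)

    touches? : ∀ t s → Dec (Touches t s)
    touches? t s = Any.any? (near? near (centre s)) (bag t)

    -- Cut the forest above every node whose bag is far from the centre of the piece of its parent;
    -- Top t s says that s is the root of the piece of t.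
    data Top : Fin m → Fin m → Set where
      root : ∀ {t} → par t ≡ nothing → Top t t
      stay : ∀ {t p s} → par t ≡ just p → Top p s → Touches t s → Top t s
      cut  : ∀ {t p s} → par t ≡ just p → Top p s → ¬ Touches t s → Top t t

    find-top : ∀ d t → dep t < d → ∃ (Top t)
    find-top (suc d) t lt with par t in e
    ... | nothing = t , root e
    ... | just p with find-top d p (<-≤-trans (par< e) (s≤s⁻¹ lt))
    ...   | s , ps with touches? t s
    ...     | yes ts = s , stay e ps ts
    ...     | no ¬ts = t , cut e ps ¬ts

    top : Fin m → Fin m
    top t = proj₁ (find-top (suc (dep t)) t ≤-refl)

    top-Top : ∀ t → Top t (top t)
    top-Top t = proj₂ (find-top (suc (dep t)) t ≤-refl)

    just≢nothing : ∀ {t p} → par t ≡ just p → par t ≡ nothing → ⊥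
    just≢nothing e e′ with () ← ≡.trans (≡.sym e) e′

    Top-unique : ∀ {t s s′} → Top t s → Top t s′ → s ≡ s′
    Top-unique (root _)     (root _)       = refl
    Top-unique (root e)     (stay e′ _ _)  = ⊥-elim (just≢nothing e′ e)
    Top-unique (root e)     (cut e′ _ _)   = refl
    Top-unique (stay e _ _) (root e′)      = ⊥-elim (just≢nothing e e′)
    Top-unique (stay e p _) (stay e′ p′ _) with refl ← par-unique e e′ = Top-unique p p′
    Top-unique (stay e p x) (cut e′ p′ ¬x) with refl ← par-unique e e′ with refl ← Top-unique p p′ = contradiction x ¬x
    Top-unique (cut e _ _)  (root e′)      = refl
    Top-unique (cut e p ¬x) (stay e′ p′ x) with refl ← par-unique e e′ with refl ← Top-unique p p′ = contradiction x ¬x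
    Top-unique (cut _ _ _)  (cut _ _ _)    = refl

    Top⇒top : ∀ {t s} → Top t s → top t ≡ s
    Top⇒top ts = Top-unique (top-Top _) ts

    Top-idem : ∀ {t s} → Top t s → Top s s
    Top-idem ts@(root _)    = ts
    Top-idem (stay _ ps _)  = Top-idem ps
    Top-idem ts@(cut _ _ _) = ts

    top-idem : ∀ t → top (top t) ≡ top t
    top-idem t = Top⇒top (Top-idem (top-Top t))

    Top⇒⊑ : ∀ {t s} → Top t s → s ⊑ t
    Top⇒⊑ (root _)      = self
    Top⇒⊑ (stay e ps _) = up e (Top⇒⊑ ps)
    Top⇒⊑ (cut _ _ _)   = self

    top⊑ : ∀ t → top t ⊑ t
    top⊑ t = Top⇒⊑ (top-Top t)

    -- Otherwise `s` would join the piece of `p`, and as the root of that piece it would lie above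
    -- its own parent.
    piece-root-far : ∀ {s p} → top s ≡ s → par s ≡ just p → ¬ Touches s (top p)
    piece-root-far {s} {p} eq e x =
      par⋢ e (subst (_⊑ p) (≡.trans (≡.sym (Top⇒top (stay e (top-Top p) x))) eq) (top⊑ p))

    -- The cut edges are deleted. The same `dep` serves, as it only has to increase from parent to
    -- child.
    pieces : Forest m
    pieces = record { par = par′ ; dep = dep ; par< = λ {t} {p} e → par< (proj₁ (par′-just t p e)) }
      module Pieces where
      par′ : Fin m → Maybe (Fin m)
      par′ t with par t
      ... | nothing = nothing
      ... | just p with touches? t (top p)
      ...   | yes _ = just p
      ...   | no _  = nothing

      par′-just : ∀ t p → par′ t ≡ just p → par t ≡ just p × Touches t (top p)
      par′-just t p eq with par t
      ... | just p′ with touches? t (top p′) | eq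
      ...   | yes x | refl = refl , x

      just-par′ : ∀ {t p} → par t ≡ just p → Touches t (top p) → par′ t ≡ just p
      just-par′ {t} {p} e x with just p ← par t | refl ← e with touches? t (top p)
      ... | yes _ = refl
      ... | no ¬x = contradiction x ¬x
    open Pieces using (par′; par′-just; just-par′)
    module ′ = Forest pieces

    top-par′ : ∀ {t p} → par′ t ≡ just p → top t ≡ top p
    top-par′ {t} {p} e = let e′ , x = par′-just t p e in Top⇒top (stay e′ (top-Top p) x)

    ⊑′⇒⊑ : ∀ {s t} → s ′.⊑ t → s ⊑ t
    ⊑′⇒⊑ ′.self      = self
    ⊑′⇒⊑ (′.up e st) = up (proj₁ (par′-just _ _ e)) (⊑′⇒⊑ st)

    ⊑′⇒top≡ : ∀ {s t} → s ′.⊑ t → top s ≡ top t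
    ⊑′⇒top≡ ′.self      = refl
    ⊑′⇒top≡ (′.up e st) = ≡.trans (⊑′⇒top≡ st) (≡.sym (top-par′ e))

    -- The way up from `t` to `s` either meets no cut edge or leaves the piece of `t` through its
    -- root.
    ⊑-cases : ∀ {s t} → s ⊑ t → s ′.⊑ t ⊎ ∃ λ p → par (top t) ≡ just p × s ⊑ p
    ⊑-cases self = inj₁ ′.self
    ⊑-cases {s} {t} (up {p = p} e sp) with touches? t (top p)
    ... | no ¬x = inj₂ (p , ≡.trans (cong par (Top⇒top (cut e (top-Top p) ¬x))) e , sp)
    ... | yes x with ⊑-cases sp
    ...   | inj₁ sp′          = inj₁ (′.up (just-par′ e x) sp′)
    ...   | inj₂ (p′ , e′ , sp′) = inj₂ (p′ , ≡.trans (cong par (Top⇒top (stay e (top-Top p) x))) e′ , sp′)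

    par-top⊑ : ∀ {t p} → par (top t) ≡ just p → p ⊑ t
    par-top⊑ {t} e = ⊑-trans (up e self) (top⊑ t)

    ⊑⇒⊑′ : ∀ {s t} → s ⊑ t → top s ≡ top t → s ′.⊑ t
    ⊑⇒⊑′ {s} {t} st eq with ⊑-cases st
    ... | inj₁ st′ = st′
    ... | inj₂ (p , e , sp) = contradiction (⊑-trans (subst (_⊑ s) eq (top⊑ s)) sp) (par⋢ e)

    piece-root⊑top : ∀ {s t} → top s ≡ s → s ⊑ t → s ⊑ top t
    piece-root⊑top {s} eq st with ⊑-cases st
    ... | inj₁ st′          = subst (_⊑ _) eq (subst (top s ⊑_) (⊑′⇒top≡ st′) self)
    ... | inj₂ (p , e , sp) = up e sp

    -- Moving pushes the border of a piece ρ away from the bag above it. As a relation, it lets a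
    -- case split also reveal why `v` stays or moves.
    data Home′ (v : V G) : Fin m → Set where
      stay : ¬ Near ρ (parentBag (top (home v))) v → Home′ v (home v)
      move : ∀ {p} → par (top (home v)) ≡ just p → Near ρ (bag p) v → Home′ v p

    find-home′ : ∀ v → ∃ (Home′ v)
    find-home′ v with near? ρ (parentBag (top (home v))) v
    ... | no ¬nr = home v , stay ¬nr
    ... | yes nr with par (top (home v)) in e
    -- Without a parent the parent bag is empty, so no vertex is near it.
    ...   | just p = p , move e nr

    home′ piece : V G → Fin m
    home′ v = proj₁ (find-home′ v)
    piece v = top (home′ v)

    home′-Home′ : ∀ v → Home′ v (home′ v)
    home′-Home′ v = proj₂ (find-home′ v)

    -- The first condition says that `v` is not moved, so the bag in question is the one above its
    -- final piece.
    Ring : V G → Set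
    Ring v = ¬ Near ρ (parentBag (top (home v))) v × Near (2 * ρ) (parentBag (top (home v))) v

    ring? : ∀ v → Dec (Ring v)
    ring? v = ¬? (near? ρ _ v) ×-dec near? (2 * ρ) _ v

    Core : V G → Set
    Core v = Near far (centre (piece v)) v

    core? : ∀ v → Dec (Core v)
    core? v = near? far _ v

    X′ : V G → Set
    X′ v = X v × ¬ Ring v × ¬ Core v

    Home′⊑ : ∀ {v t} → Home′ v t → t ⊑ home v
    Home′⊑ (stay _)   = self
    Home′⊑ (move e _) = par-top⊑ e

    home′⊑ : ∀ v → home′ v ⊑ home v
    home′⊑ v = Home′⊑ (home′-Home′ v)

    c≤ρ : c ≤ ρ
    c≤ρ = m≤n+m c δ

    2ρ≤M : 2 * ρ ≤ reach (suc k) δ c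
    2ρ≤M = m≤n+m (2 * ρ) M′

    δ≤M : δ ≤ reach (suc k) δ c
    δ≤M = ≤-trans (≤-trans (m≤m+n δ c) (m≤m+n ρ _)) 2ρ≤M

    M′≤M : M′ ≤ reach (suc k) δ c
    M′≤M = m≤m+n M′ _

    ρ≤2ρ : ρ ≤ 2 * ρ
    ρ≤2ρ = m≤m+n ρ _

    -- A short path from `v` to the bag two pieces up would pass near the bag of its old piece root.
    -- That bag would then touch the centre of the parent piece, and the edge would not have been
    -- cut.
    moved-far : ∀ {v p p′} → X v → par (top (home v)) ≡ just p → par (top p) ≡ just p′ →
                ¬ Near (2 * ρ) (bag p′) v
    moved-far {v} {p} {p′} xv e e′ nr =
      piece-root-far (top-idem (home v)) e
        (Any.map (λ {x} d → Any.map (dist-mono (≤-reflexive (eq ρ c)) ∘ dist-trans (dist-sym d)) centre-near)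
          (separates-bag xv (top⊑ (home v)) e (par-top⊑ e′) 2ρ≤M nr))
      where
      eq : ∀ ρ c → 2 * ρ + c + 2 * ρ ≡ 4 * ρ + c
      eq = solve-∀
      centre-near : Near (2 * ρ) (centre (top p)) v
      centre-near = near-parent⇒centre e′ nr

    -- Either the path passes near the bag above the piece of `v`, or `u` was moved out of that
    -- piece.
    Crossing : V G → V G → ℕ → Set
    Crossing u v r = ∃ λ p → par (piece v) ≡ just p ×
      (Near (r + c) (bag p) v ⊎ (Near ρ (parentBag (top (home u))) u × Near (r + ρ) (bag p) v))

    -- By the depths, the root `s` of the piece of `v` is not above the new home of `u`. It is not
    -- above the old home either, so `separates` applies, unless `u` was moved out of the piece of
    -- `s` and hence is within ρ of the bag above it.
    cross : ∀ {u v r} → X u → X v → r ≤ reach (suc k) δ c → DistLe G u v r →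
            piece u ≢ piece v → dep (piece u) ≤ dep (piece v) →
            Crossing u v r
    cross {u} {v} {r} xu xv r≤M d neq le = go (home′-Home′ u) refl
      where
      s = piece v
      s-root : top s ≡ s
      s-root = top-idem (home′ v)
      s⊑v : s ⊑ home v
      s⊑v = ⊑-trans (top⊑ (home′ v)) (home′⊑ v)
      s⋢u : ¬ s ⊑ home′ u
      s⋢u su = neq (≡.sym (⊑-shallow (piece-root⊑top s-root su) le))
      separated : ¬ s ⊑ home u → Crossing u v r
      separated ¬su = let p , e , nr = separates xu xv s⊑v ¬su r≤M d in p , e , inj₁ nr
      go : ∀ {t} → Home′ u t → home′ u ≡ t → Crossing u v r
      go (stay _) eq = separated (λ su → s⋢u (subst (s ⊑_) (≡.sym eq) su))
      go (move {p} e nr) eq with top (home u) Fin.≟ s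
      ... | yes top≡s = p , ≡.trans (cong par (≡.sym top≡s)) e ,
                        inj₂ (subst (λ b → Near ρ b u) (≡.sym (parentBag-just e)) nr , near-trans (dist-sym d) nr)
      ... | no top≢s = separated λ su → case⊥ (⊑-cases su)
        where
        case⊥ : s ′.⊑ home u ⊎ (∃ λ p → par (top (home u)) ≡ just p × s ⊑ p) → ⊥
        case⊥ (inj₁ su) = top≢s (≡.trans (≡.sym (⊑′⇒top≡ su)) s-root)
        case⊥ (inj₂ (p′ , e′ , sp)) with refl ← par-unique e e′ = s⋢u (subst (s ⊑_) (≡.sym eq) sp)

    cross-near : ∀ {u v r} → X u → X v → r ≤ reach (suc k) δ c → DistLe G u v r →
            piece u ≢ piece v → dep (piece u) ≤ dep (piece v) → Near (r + ρ) (centre (piece v)) v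
    cross-near {r = r} xu xv r≤M d neq le with cross xu xv r≤M d neq le
    ... | p , e , inj₁ nr       = near-parent⇒centre e (near-mono (+-monoʳ-≤ r c≤ρ) nr)
    ... | p , e , inj₂ (_ , nr) = near-parent⇒centre e nr

    -- By `moved-far`, `v` was not moved. If the path itself met the bag above the piece, `v` would
    -- be within δ + c = ρ of it and would have been moved. So `u` was moved and is no ring vertex,
    -- while `v` is within δ + ρ of that bag.
    cross-ring : ∀ {u v} → X u → X v → DistLe G u v δ → piece u ≢ piece v → dep (piece u) ≤ dep (piece v) →
                 Ring v × ¬ Ring u
    cross-ring {u} {v} xu xv d neq le = go (cross xu xv δ≤M d neq le) (home′-Home′ v) refl
      where
      δ+ρ≤2ρ : δ + ρ ≤ 2 * ρ
      δ+ρ≤2ρ = +-mono-≤ (m≤m+n δ c) (≤-reflexive (≡.sym (+-identityʳ ρ)))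
      go : Crossing u v δ → ∀ {t} → Home′ v t → home′ v ≡ t → Ring v × ¬ Ring u
      go (p , e , inj₁ nr) (stay ¬nr) eq =
        contradiction (subst (λ b → Near ρ b v) (≡.sym (parentBag-just (subst (λ t → par (top t) ≡ just p) eq e))) nr) ¬nr
      go (p , e , inj₂ (nru , nr)) (stay ¬nr) eq =
        (¬nr , near-mono δ+ρ≤2ρ (subst (λ b → Near (δ + ρ) b v) (≡.sym (parentBag-just (subst (λ t → par (top t) ≡ just p) eq e))) nr))
        , λ { (¬nru , _) → ¬nru nru }
      go (p , e , inj₁ nr) (move e′ _) eq =
        ⊥-elim (moved-far xv e′ (subst (λ t → par (top t) ≡ just p) eq e) (near-mono ρ≤2ρ nr))
      go (p , e , inj₂ (_ , nr)) (move e′ _) eq =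
        ⊥-elim (moved-far xv e′ (subst (λ t → par (top t) ≡ just p) eq e) (near-mono δ+ρ≤2ρ nr))

    -- By `cross-ring`, a step between pieces has exactly one end on a ring.
    same-piece : ∀ {u v} → X u → X v → DistLe G u v δ → (Ring u × Ring v) ⊎ (¬ Ring u × ¬ Ring v) →
                 piece u ≡ piece v
    same-piece {u} {v} xu xv d rings with piece u Fin.≟ piece v
    ... | yes eq = eq
    ... | no neq with ≤-total (dep (piece u)) (dep (piece v)) | rings
    ...   | inj₁ le | inj₁ (ru , rv)   = contradiction ru (proj₂ (cross-ring xu xv d neq le))
    ...   | inj₁ le | inj₂ (¬ru , ¬rv) = contradiction (proj₁ (cross-ring xu xv d neq le)) ¬rv
    ...   | inj₂ le | inj₁ (ru , rv)   = contradiction rv (proj₂ (cross-ring xv xu (dist-sym d) (λ eq → neq (≡.sym eq)) le))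
    ...   | inj₂ le | inj₂ (¬ru , ¬rv) = contradiction (proj₁ (cross-ring xv xu (dist-sym d) (λ eq → neq (≡.sym eq)) le)) ¬ru

    r+ρ≤far : ∀ {r} → r ≤ M′ → r + ρ ≤ far
    r+ρ≤far r≤M′ = ≤-trans (+-monoˡ-≤ ρ r≤M′) (m≤m+n (M′ + ρ) near)

    -- Otherwise the vertex in the piece with the deeper root would lie in its core.
    same-piece′ : ∀ {u v r} → X′ u → X′ v → r ≤ M′ → DistLe G u v r → piece u ≡ piece v
    same-piece′ {u} {v} {r} (xu , _ , ¬cu) (xv , _ , ¬cv) r≤M′ d with piece u Fin.≟ piece v
    ... | yes eq = eq
    ... | no neq with ≤-total (dep (piece u)) (dep (piece v))
    ...   | inj₁ le = contradiction (near-mono (r+ρ≤far r≤M′) (cross-near xu xv (≤-trans r≤M′ M′≤M) d neq le)) ¬cv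
    ...   | inj₂ le = contradiction (near-mono (r+ρ≤far r≤M′) (cross-near xv xu (≤-trans r≤M′ M′≤M) (dist-sym d) (λ eq → neq (≡.sym eq)) le)) ¬cu

    away? : ∀ t x → Dec (¬ Near near (centre (top t)) x)
    away? t x = ¬? (near? near (centre (top t)) x)

    bag′ : Fin m → List (V G)
    bag′ t = filter (away? t) (bag t)

    -- A nonempty bag loses a vertex: the bag of a piece root belongs to the centre, and any other
    -- bag of the piece touches it.
    bag′-size : ∀ t → length (bag′ t) ≤ k
    bag′-size t with bag t in eq
    ... | []     = z≤n
    ... | x ∷ xs = s≤s⁻¹ (≤-trans (List.filter-notAll (away? t) (x ∷ xs) (Any.map (λ nr ¬nr → ¬nr nr) (touching (top-Top t))))
                                  (subst (λ b → length b ≤ suc k) eq (bag-size t)))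
      where
      in-centre : Near near (centre t) x
      in-centre = Any.++⁺ʳ (parentBag t) (subst (λ b → Near near b x) (≡.sym eq) (here dist-refl))
      touching : ∀ {s} → Top t s → Any (Near near (centre s)) (x ∷ xs)
      touching (root _)      = here in-centre
      touching (cut _ _ _)   = here in-centre
      touching (stay _ _ ts) = subst (Any _) eq ts

    -- The bag vertex close to `v` survives the filter, for if it were near the centre, `v` would be
    -- in the core.
    keep : ∀ {v t r} → X′ v → top t ≡ piece v → r ≤ M′ → Near (r + c) (bag t) v ⊎ Near (r + ρ) (bag t) v →
           Near (r + ρ) (bag′ t) v
    keep {r = r} xv eq r≤M′ (inj₁ nr) = keep xv eq r≤M′ (inj₂ (near-mono (+-monoʳ-≤ r c≤ρ) nr))
    keep {v} {t} {r} (_ , _ , ¬core) eq r≤M′ (inj₂ nr) with find nr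
    ... | x , x∈ , d = lose (∈-filter⁺ (away? t) x∈ away) d
      where
      away : ¬ Near near (centre (top t)) x
      away nx = ¬core (subst (λ s → Near far (centre s) v) eq
                        (near-mono (+-monoˡ-≤ near (+-monoˡ-≤ ρ r≤M′)) (near-trans d nx)))

    -- The error grows from c to ρ because a moved vertex is only within ρ of the bag of its new
    -- home.
    smaller : CoarseDecomposition m k ρ M′
    smaller = record
      { forest = pieces ; bag = bag′ ; bag-size = bag′-size ; X = X′ ; home = home′
      ; near-home = near-home′ ; separates = separates′ ; separates-bag = separates-bag′ }
      where
      near-home′ : ∀ {v} → X′ v → Near ρ (bag′ (home′ v)) v
      near-home′ {v} xv = keep {r = 0} xv refl z≤n (go (home′-Home′ v))
        where
        go : ∀ {t} → Home′ v t → Near c (bag t) v ⊎ Near ρ (bag t) v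
        go (stay _)    = inj₁ (near-home (proj₁ xv))
        go (move _ nr) = inj₂ nr

      separates′ : ∀ {u v s r} → X′ u → X′ v → s ′.⊑ home′ v → ¬ s ′.⊑ home′ u → r ≤ M′ → DistLe G u v r →
                   ∃ λ p → par′ s ≡ just p × Near (r + ρ) (bag′ p) v
      separates′ {u} {v} {s} {r} xu xv sv ¬su r≤M′ d = p , e′ , keep xv (≡.trans (≡.sym (top-par′ e′)) (⊑′⇒top≡ sv)) r≤M′ (inj₁ nr)
        where
        top-s : top s ≡ piece u
        top-s = ≡.trans (⊑′⇒top≡ sv) (≡.sym (same-piece′ xu xv r≤M′ d))
        s⋢u : ¬ s ⊑ home′ u
        s⋢u su = ¬su (⊑⇒⊑′ su top-s)
        -- If `u` was moved, `s` cannot lie in the piece it left, since `s` is in the piece of its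
        -- new home.
        not-home : ∀ {t} → Home′ u t → home′ u ≡ t → ¬ s ⊑ home u
        not-home (stay _) eq su = s⋢u (subst (s ⊑_) (≡.sym eq) su)
        not-home (move {p} e _) eq su with ⊑-cases su
        ... | inj₁ su′ = par⋢ e (subst (_⊑ p) (≡.trans (≡.sym (≡.trans top-s (cong top eq))) (⊑′⇒top≡ su′)) (top⊑ p))
        ... | inj₂ (p′ , e′ , sp) with refl ← par-unique e e′ = s⋢u (subst (s ⊑_) (≡.sym eq) sp)
        found = separates (proj₁ xu) (proj₁ xv) (⊑-trans (⊑′⇒⊑ sv) (home′⊑ v)) (not-home (home′-Home′ u) refl)
                  (≤-trans r≤M′ M′≤M) d
        p = proj₁ found
        e = proj₁ (proj₂ found)
        nr = proj₂ (proj₂ found)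
        -- If this edge were cut, `s` would be the root of the piece of `u` and thus above
        -- `home′ u`.
        e′ : par′ s ≡ just p
        e′ with touches? s (top p)
        ... | yes x = just-par′ e x
        ... | no ¬x = contradiction (subst (_⊑ home′ u) (≡.trans (≡.sym top-s) (Top⇒top (cut e (top-Top p) ¬x))) (top⊑ (home′ u))) s⋢u

      separates-bag′ : ∀ {v s p t r} → X′ v → s ′.⊑ home′ v → par′ s ≡ just p → t ′.⊑ p → r ≤ M′ →
                       Near r (bag′ t) v → Near (r + ρ) (bag′ s) v
      separates-bag′ {v} {t = t} xv sv e tp r≤M′ nr =
        keep xv (⊑′⇒top≡ sv) r≤M′ (inj₁
          (separates-bag (proj₁ xv) (⊑-trans (⊑′⇒⊑ sv) (home′⊑ v)) (proj₁ (par′-just _ _ e)) (⊑′⇒⊑ tp)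
            (≤-trans r≤M′ M′≤M)
            (let x , x∈ , d = find nr in lose (proj₁ (∈-filter⁻ (away? t) x∈)) d)))

    module _ (colour′ : V G → Bool) (good′ : ∀ b → Bounded Δ (λ w → X′ w × colour′ w ≡ b) D′) where

      colour : V G → Bool
      colour v with ring? v
      ... | yes _ = true
      ... | no _ with core? v
      ...   | yes _ = false
      ...   | no _  = colour′ v

      colour-true : ∀ {v} → X v × colour v ≡ true → (X′ v × colour′ v ≡ true) ⊎ (X v × Ring v)
      colour-true {v} (xv , eq) with ring? v
      ... | yes rv = inj₂ (xv , rv)
      ... | no ¬rv with core? v
      ...   | no ¬cv = inj₁ ((xv , ¬rv , ¬cv) , eq)

      colour-false : ∀ {v} → X v × colour v ≡ false → ¬ Ring v × (Core v ⊎ (X′ v × colour′ v ≡ false))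
      colour-false {v} (xv , eq) with ring? v
      ... | no ¬rv with core? v
      ...   | yes cv = ¬rv , inj₁ cv
      ...   | no ¬cv = ¬rv , inj₂ ((xv , ¬rv , ¬cv) , eq)

      -- By `same-piece` the chain keeps to one piece, hence to the 2ρ-balls around one bag.
      ring-bounded : Bounded δ (λ w → X w × Ring w) A
      ring-bounded {u} ch = balls-bounded (suc k) (parentBag (piece u)) (parentBag-size (piece u))
        (chain-map ≤-refl (λ {w} → on-ring {w})
          (chain-invariant piece (λ { (xx , rx) (xy , ry) d → same-piece xx xy d (inj₁ (rx , ry)) }) ch))
        where
        on-ring : ∀ {w} → (X w × Ring w) × piece w ≡ piece u → Near (2 * ρ) (parentBag (piece u)) w
        on-ring {w} ((_ , ¬nr , nr) , eq) = go (home′-Home′ w) refl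
          where
          go : ∀ {t} → Home′ w t → home′ w ≡ t → Near (2 * ρ) (parentBag (piece u)) w
          go (stay _) e = subst (λ s → Near (2 * ρ) (parentBag s) w) (≡.trans (cong top (≡.sym e)) eq) nr
          go (move e nr′) _ = contradiction (subst (λ b → Near ρ b w) (≡.sym (parentBag-just e)) nr′) ¬nr

      -- Skipping the runs in rings leaves a Δ-chain, and Δ is the scale of the recursive colouring.
      good-true : Bounded δ (λ w → X w × colour w ≡ true) (D′ + 2 * (A + δ))
      good-true = absorb colour-true ring-bounded (good′ true)

      -- The chain avoids rings and so stays in one piece. Here the recursively coloured runs are
      -- skipped, and the core vertices left lie in balls around one centre, which are bounded at
      -- any scale.
      good-false : Bounded δ (λ w → X w × colour w ≡ false)
                     (ballBound (suc k + suc k) (D′ + 2 * δ) far + 2 * (D′ + δ))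
      good-false {u} ch =
        absorb {P = Near far (centre (piece u))} {Q = λ w → X′ w × colour′ w ≡ false}
          (λ { {w} (cw , eq) → split-core cw eq })
          (λ q → good′ false (chain-map (≤-trans (m≤m+n δ _) (m≤n+m (2 * δ) A)) (λ x → x) q))
          (balls-bounded (suc k + suc k) (centre (piece u)) (centre-size (piece u)))
          (chain-invariant piece
            (λ { cx@(xx , _) cy@(xy , _) d →
                 same-piece xx xy d (inj₂ (proj₁ (colour-false cx) , proj₁ (colour-false cy))) })
            ch)
        where
        split-core : ∀ {w} → X w × colour w ≡ false → piece w ≡ piece u →
                     Near far (centre (piece u)) w ⊎ (X′ w × colour′ w ≡ false)
        split-core {w} cw eq with proj₂ (colour-false cw)
        ... | inj₁ core = inj₁ (subst (λ s → Near far (centre s) w) eq core)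
        ... | inj₂ xw   = inj₂ xw

  two-colouring : ∀ {m} k δ c (O : CoarseDecomposition m k c (reach k δ c)) →
    let open CoarseDecomposition O in
    Σ (V G → Bool) λ colour → ∀ b → Bounded δ (λ w → X w × colour w ≡ b) (diameter k δ c)
  -- All bags are empty, so `near-home` leaves no vertex in `X`.
  two-colouring zero δ c O = (λ _ → true) , λ b ch → ⊥-elim (empty (proj₁ (chain-head ch)))
    where
    open CoarseDecomposition O
    empty : ∀ {v} → ¬ X v
    empty {v} xv with bag (home v) | bag-size (home v) | near-home xv
    ... | x ∷ xs | () | _
  two-colouring (suc k) δ c O with two-colouring k _ _ (Step.smaller δ c O)
  ... | colour′ , good′ = colour colour′ good′ , λ
    { true  ch → dist-mono (m≤m+n _ _) (good-true colour′ good′ ch)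
    ; false ch → dist-mono (m≤n+m _ (D′ + 2 * (A + δ))) (good-false colour′ good′ ch) }
    where open Step δ c O

-- Simple walks and rooting a tree by distance.

least : ∀ {P : ℕ → Set} → (∀ l → Dec (P l)) → ∀ k → (∃ λ l → l < k × P l) →
        ∃ λ l → P l × (∀ {j} → P j → l ≤ j)
least P? (suc k) (l , l<1+k , p) with anyUpTo? P? k
... | yes q = least P? k q
... | no ¬q = l , p , λ {j} q → ≮⇒≥ λ j<l → ¬q (j , <-≤-trans j<l (s≤s⁻¹ l<1+k) , q)

edge-sym : ∀ G {u v} → Edge G u v → Edge G v u
edge-sym G {u} {v} e = ≡.trans (sym G v u) e

edge-≢ : ∀ G {u v} → Edge G u v → u ≢ v
edge-≢ G {u} e refl with () ← ≡.trans (≡.sym e) (irrefl G u)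

module _ {G : Graph} where

  within-map : ∀ {P Q u v} → (∀ {w} → P w → Q w) → WalkWithin G P u v → WalkWithin G Q u v
  within-map f (here p)     = here (f p)
  within-map f (step p e q) = step (f p) e (within-map f q)

  within-++ : ∀ {P u v w} → WalkWithin G P u v → WalkWithin G P v w → WalkWithin G P u w
  within-++ (here _)     r = r
  within-++ (step p e q) r = step p e (within-++ q r)

  within-head : ∀ {P u v} → WalkWithin G P u v → P u
  within-head (here p)     = p
  within-head (step p _ _) = p

  within-reverse : ∀ {P u v} → WalkWithin G P u v → WalkWithin G P v u
  within-reverse (here p)     = here p
  within-reverse (step p e q) =
    within-++ (within-reverse q) (step (within-head q) (edge-sym G e) (here p))

  within⇒walk : ∀ {P u v} → WalkWithin G P u v → ∃ (Walk G u v)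
  within⇒walk (here _)     = 0 , here
  within⇒walk (step _ e q) = let l , w = within⇒walk q in suc l , step e w

  data Simple (P : V G → Set) : V G → V G → List (V G) → Set where
    stop   : ∀ {u} → P u → Simple P u u (u ∷ [])
    extend : ∀ {u w v xs} → P u → Edge G u w → Simple P w v xs → ¬ u ∈ xs → Simple P u v (u ∷ xs)

  suffix : ∀ {P u v x xs} → Simple P u v xs → x ∈ xs → ∃ (Simple P x v)
  suffix s@(stop _)     (here refl) = _ , s
  suffix s@(extend _ _ _ _) (here refl) = _ , s
  suffix (extend _ _ s _)   (there x∈)  = suffix s x∈

  erase-loops : ∀ {P u v} → WalkWithin G P u v → ∃ (Simple P u v)
  erase-loops (here p) = _ , stop p
  erase-loops {u = u} (step p e q) with erase-loops q
  ... | xs , s with Any.any? (u Fin.≟_) xs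
  ...   | yes u∈ = suffix s u∈
  ...   | no u∉  = _ , extend p e s u∉

  simple-all : ∀ {P u v xs} → Simple P u v xs → All P xs
  simple-all (stop p)     = p ∷ []
  simple-all (extend p _ s _) = p ∷ simple-all s

  simple-unique : ∀ {P u v xs} → Simple P u v xs → Unique xs
  simple-unique (stop _)      = [] ∷ []
  simple-unique (extend _ _ s u∉) = ¬Any⇒All¬ _ u∉ ∷ simple-unique s

  simple-linked : ∀ {P a u v b xs} → Edge G a u → Simple P u v xs → Edge G v b →
                  Linked (Edge G) (a ∷ xs ++ b ∷ [])
  simple-linked e (stop _)      e′ = e ∷ e′ ∷ [-]
  simple-linked e (extend _ e₁ s _) e′ = e ∷ simple-linked e₁ s e′

  simple-length : ∀ {P u v xs} → u ≢ v → Simple P u v xs → 2 ≤ length xs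
  simple-length u≢v (stop _)               = contradiction refl u≢v
  simple-length u≢v (extend _ _ (stop _) _)     = s≤s (s≤s z≤n)
  simple-length u≢v (extend _ _ (extend _ _ _ _) _) = s≤s (s≤s z≤n)

module Rooted (T : Graph) (isTree : IsTree T) where
  open Metric T using (walk?)

  root : V T
  root = fromℕ< (proj₁ isTree)

  level : ∀ t → ∃ λ l → Walk T t root l × (∀ {j} → Walk T t root j → l ≤ j)
  level t = let l , w = within⇒walk (proj₁ (proj₂ isTree) t root) in
            least (walk? t root) (suc l) (l , ≤-refl , w)

  dep : V T → ℕ
  dep t = proj₁ (level t)

  parent : ∀ t → (t ≡ root) ⊎ ∃ λ p → Edge T t p × dep p < dep t
  parent t with level t
  ... | zero  , here       , _ = inj₁ refl
  ... | suc l , step {w = p} e w , _ = inj₂ (p , e , s≤s (proj₂ (proj₂ (level p)) w))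

  par : V T → Maybe (V T)
  par t with parent t
  ... | inj₁ _       = nothing
  ... | inj₂ (p , _) = just p

  par-just : ∀ {t p} → par t ≡ just p → Edge T t p × dep p < dep t
  par-just {t} eq with parent t | eq
  ... | inj₂ (p , e , lt) | refl = e , lt

  forest : Forest (n T)
  forest = record { par = par ; dep = dep ; par< = proj₂ ∘ par-just }

  climb : ∀ {P} d t → dep t < d → P t → (∀ {s} → dep s < dep t → P s) → WalkWithin T P t root
  climb (suc d) t lt pt below with parent t
  ... | inj₁ refl = here pt
  ... | inj₂ (p , e , p<t) =
    step pt e (climb d p (<-≤-trans p<t (s≤s⁻¹ lt)) (below p<t) (λ s<p → below (<-trans s<p p<t)))

  -- If `b` had another parent `p`, the climbs from `a` and `p` to the root would avoid `b` and give
  -- a simple path from `a` to `p`, closing a cycle through `b`.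
  deeper-end : ∀ {a b} → Edge T a b → dep a ≤ dep b → par b ≡ just a
  deeper-end {a} {b} e le with parent b
  ... | inj₁ refl = contradiction (root-unique (≤-trans le (proj₂ (proj₂ (level root)) here))) (edge-≢ T e)
    where
    root-unique : ∀ {t} → dep t ≤ 0 → t ≡ root
    root-unique {t} z with level t
    root-unique {t} z≤n | zero , here , _ = refl
  ... | inj₂ (p , e′ , p<b) with p Fin.≟ a
  ...   | yes refl = refl
  ...   | no p≢a = ⊥-elim (proj₂ (proj₂ isTree) (b , xs , s≤s (simple-length (p≢a ∘ ≡.sym) simple) ,
                     simple-all simple ∷ simple-unique simple , simple-linked (edge-sym T e) simple (edge-sym T e′)))
    where
    shallow : ∀ {s} → dep s < dep b → b ≢ s
    shallow lt refl = <-irrefl refl lt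
    detour : WalkWithin T (b ≢_) a p
    detour = within-++ (climb _ a ≤-refl (edge-≢ T e ∘ ≡.sym) (λ s<a → shallow (<-≤-trans s<a le)))
               (within-reverse (climb _ p ≤-refl (shallow p<b) (λ s<p → shallow (<-trans s<p p<b))))
    xs = proj₁ (erase-loops detour)
    simple = proj₂ (erase-loops detour)

  edge-par : ∀ {a b} → Edge T a b → par a ≡ just b ⊎ par b ≡ just a
  edge-par {a} {b} e with ≤-total (dep a) (dep b)
  ... | inj₁ le = inj₂ (deeper-end e le)
  ... | inj₂ le = inj₁ (deeper-end (edge-sym T e) le)

  open Forest forest using (_⊑_; self; up; par-unique)

  -- Since every edge joins a node to its parent, a walk leaves the subtree of s only along s – par s.
  leave-subtree : ∀ {P a b s} → WalkWithin T P a b → s ⊑ a → ¬ s ⊑ b → ∃ λ p → par s ≡ just p × P s × P p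
  leave-subtree (here _) sa ¬sb = contradiction sa ¬sb
  leave-subtree (step pa e q) sa ¬sb with edge-par e
  ... | inj₂ w↑a = leave-subtree q (up w↑a sa) ¬sb
  ... | inj₁ a↑w with sa
  ...   | self     = _ , a↑w , pa , within-head q
  ...   | up e′ sp with refl ← par-unique a↑w e′ = leave-subtree q sp ¬sb

-- From tree-decompositions to coarse decompositions.

elements : ∀ {n} → Subset n → List (Fin n)
elements []            = []
elements (outside ∷ p) = map suc (elements p)
elements (inside ∷ p)  = zero ∷ map suc (elements p)

length-elements : ∀ {n} (p : Subset n) → length (elements p) ≡ ∣ p ∣
length-elements []            = refl
length-elements (outside ∷ p) = ≡.trans (List.length-map suc (elements p)) (length-elements p)
length-elements (inside ∷ p)  = cong suc (≡.trans (List.length-map suc (elements p)) (length-elements p))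

∈-elements⁺ : ∀ {n} {p : Subset n} {x} → x Subset.∈ p → x ∈ elements p
∈-elements⁺ {p = inside ∷ p}  here       = here refl
∈-elements⁺ {p = inside ∷ p}  (there x∈) = there (∈-map⁺ suc (∈-elements⁺ x∈))
∈-elements⁺ {p = outside ∷ p} (there x∈) = ∈-map⁺ suc (∈-elements⁺ x∈)

∈-elements⁻ : ∀ {n} (p : Subset n) {x} → x ∈ elements p → x Subset.∈ p
∈-elements⁻ (outside ∷ p) x∈ with _ , y∈ , refl ← ∈-map⁻ suc x∈ = there (∈-elements⁻ p y∈)
∈-elements⁻ (inside ∷ p)  (here refl) = here
∈-elements⁻ (inside ∷ p)  (there x∈) with _ , y∈ , refl ← ∈-map⁻ suc x∈ = there (∈-elements⁻ p y∈)

-- The induced subgraph on `S`, with the other vertices kept as isolated ones so that nothing is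
-- renumbered.
module Restrict (G : Graph) {S : V G → Set} (S? : ∀ v → Dec (S v)) where

  restrict : Graph
  restrict = record
    { n      = n G
    ; adj    = λ u v → adj G u v ∧ (does (S? u) ∧ does (S? v))
    ; sym    = λ u v → ≡.cong₂ _∧_ (sym G u v) (Bool.∧-comm (does (S? u)) (does (S? v)))
    ; irrefl = λ u → cong (_∧ _) (irrefl G u)
    }

  restrict-edge⁻ : ∀ {u v} → Edge restrict u v → Edge G u v × S u × S v
  restrict-edge⁻ {u} {v} e with adj G u v | S? u | S? v | e
  ... | true | yes su | yes sv | _ = refl , su , sv

  restrict-edge⁺ : ∀ {u v} → Edge G u v → S u → S v → Edge restrict u v
  restrict-edge⁺ {u} {v} e su sv with adj G u v | e | S? u | S? v
  ... | true | _ | yes _ | yes _ = refl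
  ... | true | _ | no ¬su | _    = contradiction su ¬su
  ... | true | _ | yes _ | no ¬sv = contradiction sv ¬sv

  restrict-dist⁻ : ∀ {u v k} → DistLe restrict u v k → DistLe G u v k
  restrict-dist⁻ (l , l≤k , w) = l , l≤k , walk w
    where
    walk : ∀ {u v l} → Walk restrict u v l → Walk G u v l
    walk here       = here
    walk (step e w) = step (proj₁ (restrict-edge⁻ e)) (walk w)

  module _ {k : ℕ} (TD : TreeDecomposition G S k) where
    open TreeDecomposition TD
    open Rooted tree isTree
    open Forest forest using (par⋢; ⊑-trans)
    open Metric restrict

    node : V G → V tree
    node v with S? v
    ... | yes sv = proj₁ (vertexCov v sv)
    ... | no _   = root

    node-∈ : ∀ {v} → S v → v Subset.∈ bag (node v)
    node-∈ {v} sv with S? v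
    ... | yes sv′ = proj₂ (vertexCov v sv′)
    ... | no ¬sv  = contradiction sv ¬sv

    -- Consecutive vertices of the walk share a bag, and the bags of each vertex are connected in
    -- the tree. The resulting tree walk only meets bags that contain a vertex of the walk.
    trace : ∀ {u v a b l} → Walk restrict u v l → u Subset.∈ bag a → v Subset.∈ bag b →
            WalkWithin tree (λ t → Near l (elements (bag t)) u) a b
    trace {u} {a = a} {b} here u∈a u∈b =
      within-map (λ u∈t → lose (∈-elements⁺ u∈t) dist-refl) (subtree u a b u∈a u∈b)
    trace {u} {a = a} (step {w = w} e q) u∈a v∈b =
      let e′ , su , sw = restrict-edge⁻ e
          t , u∈t , w∈t = edgeCov u w su sw e′
      in within-++ (within-map (λ u∈t → lose (∈-elements⁺ u∈t) dist-refl) (subtree u a t u∈a u∈t))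
           (within-map (near-trans (1 , ≤-refl , step e here)) (trace q w∈t v∈b))

    coarse : ∀ M → CoarseDecomposition restrict (n tree) (suc k) 0 M
    coarse M = record
      { forest        = forest
      ; bag           = elements ∘ bag
      ; bag-size      = λ t → ≤-trans (≤-reflexive (length-elements (bag t))) (width t)
      ; X             = S
      ; home          = node
      ; near-home     = λ sv → lose (∈-elements⁺ (node-∈ sv)) dist-refl
      -- The traced tree walk leaves the subtree of `s` along its parent edge. The bags of both ends
      -- come near `v`: the parent's is used here, that of `s` in `separates-bag`.
      ; separates     = λ su sv s⊑v s⋢u _ d →
          let l , l≤r , w = dist-sym d
              p , e , _ , nr = leave-subtree (trace w (node-∈ sv) (node-∈ su)) s⊑v s⋢u
          in p , e , near-mono (≤-trans l≤r (m≤m+n _ 0)) nr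
      ; separates-bag = λ {_} {s} {p} {t} sv s⊑v e t⊑p _ nr →
          let y , y∈ , l , l≤r , w = find nr
              _ , _ , nr′ , _ = leave-subtree (trace w (node-∈ sv) (∈-elements⁻ (bag t) y∈)) s⊑v
                                  (λ s⊑t → par⋢ e (⊑-trans s⊑t t⊑p))
          in near-mono (≤-trans l≤r (m≤m+n _ 0)) nr′
      }

-- Components and controlled partitions.

module _ {m : ℕ} {R : Fin m → Fin m → Set} (R? : ∀ u v → Dec (R u v)) where

  merge : Fin m → Fin m → Fin m → Fin m
  merge a b x with x Fin.≟ b
  ... | yes _ = a
  ... | no _  = x

  merge-left : ∀ a b → merge a b a ≡ a
  merge-left a b with a Fin.≟ b
  ... | yes _ = refl
  ... | no _  = refl

  merge-right : ∀ a b → merge a b b ≡ a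
  merge-right a b with b Fin.≟ b
  ... | yes _  = refl
  ... | no b≢b = contradiction refl b≢b

  -- Union-find: each related pair merges two classes by a map on representatives, which preserves
  -- earlier equalities.
  components-of : (ps : List (Fin m × Fin m)) → ∃ λ (comp : Fin m → Fin m) →
    (∀ v → EqClosure R v (comp v)) × All (λ (u , v) → R u v → comp u ≡ comp v) ps
  components-of [] = (λ v → v) , (λ _ → ε) , []
  components-of ((a , b) ∷ ps) with components-of ps | R? a b
  ... | comp , conn , eqs | no ¬r = comp , conn , (λ r → contradiction r ¬r) ∷ eqs
  ... | comp , conn , eqs | yes r =
    merge (comp a) (comp b) ∘ comp , conn′ ,
    (λ _ → ≡.trans (merge-left (comp a) (comp b)) (≡.sym (merge-right (comp a) (comp b)))) ∷
    All.map (λ eq r → cong (merge (comp a) (comp b)) (eq r)) eqs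
    where
    conn′ : ∀ v → EqClosure R v (merge (comp a) (comp b) (comp v))
    conn′ v with comp v Fin.≟ comp b
    ... | no _   = conn v
    ... | yes eq =
      Eq.transitive R (subst (EqClosure R v) eq (conn v))
        (Eq.transitive R (Eq.symmetric R (conn b)) (bwd r ◅ conn a))

  components : ∃ λ (comp : Fin m → Fin m) →
    (∀ v → EqClosure R v (comp v)) × (∀ {u v} → R u v → comp u ≡ comp v)
  components with components-of (cartesianProduct (allFin m) (allFin m))
  ... | comp , conn , eqs =
    comp , conn , λ {u} {v} → All.lookup eqs (∈-cartesianProduct⁺ (∈-allFin u) (∈-allFin v))

module _ (G : Graph) {d δ D : ℕ} (colour : V G → Fin (suc d)) where
  open Metric G

  controlledPartition : (∀ κ → Bounded δ (λ w → colour w ≡ κ) D) → ControlledPartition G d δ D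
  controlledPartition bounded = record
    { part     = toℕ ∘ comp
    ; col      = col
    ; weakDiam = λ u v eq →
        bounded _ (chain (Eq.transitive R (connected u)
          (subst (λ c → EqClosure R c v) (≡.sym (Fin.toℕ-injective eq)) (Eq.symmetric R (connected v)))))
    ; disjoint = λ u v part≢ col≡ close → part≢ (cong toℕ (joined
        (≡.trans (colour-comp u) (≡.trans col≡ (≡.sym (colour-comp v))) , close)))
    }
    where
    R : V G → V G → Set
    R u v = colour u ≡ colour v × DistLe G u v δ

    found = components (λ u v → (colour u Fin.≟ colour v) ×-dec dist? u v δ)
    comp = proj₁ found
    connected = proj₁ (proj₂ found)
    joined = proj₂ (proj₂ found)

    chain : ∀ {u v} → EqClosure R u v → Chain δ (λ w → colour w ≡ colour u) u v
    chain ε = [ refl ]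
    chain (fwd (eq , d) ◅ rs) = cons refl d (chain-map ≤-refl (λ e → ≡.trans e (≡.sym eq)) (chain rs))
    chain (bwd (eq , d) ◅ rs) = cons refl (dist-sym d) (chain-map ≤-refl (λ e → ≡.trans e eq) (chain rs))

    -- A part is numbered by its representative and takes its colour; other numbers get a dummy
    -- colour.
    col : ℕ → Fin (suc d)
    col p with p <? n G
    ... | yes p<n = colour (fromℕ< p<n)
    ... | no _    = zero

    col-toℕ : ∀ x → col (toℕ x) ≡ colour x
    col-toℕ x with toℕ x <? n G
    ... | yes p<n = cong colour (Fin.fromℕ<-toℕ x p<n)
    ... | no ≮    = contradiction (Fin.toℕ<n x) ≮

    colour-comp : ∀ v → colour v ≡ col (toℕ (comp v))
    colour-comp v = ≡.trans (≡.sym (chain-last (chain (connected v)))) (≡.sym (col-toℕ (comp v)))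

-- Two-colouring one slab of layers.

abstract
  slabDiameter : (ℕ → ℕ) → ℕ → ℕ → ℕ
  slabDiameter f L η = diameter (suc (f (L + 2 * η))) η 0

  slab-two-colouring : ∀ H {m} f L η (O : CoarseDecomposition H m (suc (f (L + 2 * η))) 0
                         (reach (suc (f (L + 2 * η))) η 0)) →
    ∃ λ (colour : V H → Bool) →
      ∀ b → Metric.Bounded H η (λ w → CoarseDecomposition.X O w × colour w ≡ b) (slabDiameter f L η)
  slab-two-colouring H f L η O = two-colouring H (suc (f (L + 2 * η))) η 0 O

module _ (G : Graph) (layer : V G → ℕ) (layering : IsLayering G layer) where
  open Metric G

  layer-dist : ∀ {u v k} → DistLe G u v k → layer v ≤ layer u + k
  layer-dist {u} (l , l≤k , w) = ≤-trans (walk w) (+-monoʳ-≤ (layer u) l≤k)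
    where
    walk : ∀ {u v l} → Walk G u v l → layer v ≤ layer u + l
    walk here = m≤m+n _ 0
    walk {u} {v} {suc l} (step {w = w} e p) =
      ≤-trans (walk p) (≤-trans (+-monoˡ-≤ l (proj₂ (layering u w e))) (≤-reflexive (≡.sym (+-suc (layer u) l))))

  InSlab : ℕ → ℕ → V G → Set
  InSlab x L v = x ≤ layer v × layer v < x + L

  -- Short paths between vertices of a slab stay in the slab widened by η on both sides.
  slab-colouring : ∀ f x L η → (∀ ℓ i → TreewidthLe G (InSlab i ℓ) (f ℓ)) →
    ∃ λ (colour : V G → Bool) → ∀ b → Bounded η (λ w → InSlab x L w × colour w ≡ b) (slabDiameter f L η)
  slab-colouring f x L η tw = proj₁ coloured , λ b c → restrict-dist⁻ (proj₂ coloured b (chain c))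
    where
    wide? : ∀ v → Dec (InSlab (x ∸ η) (L + 2 * η) v)
    -- If η exceeds x, truncation only makes the slab reach higher.
    wide? v = (x ∸ η ≤? layer v) ×-dec (layer v <? x ∸ η + (L + 2 * η))

    open Restrict G wide?
    module H = Metric restrict

    coloured : ∃ λ (colour : V G → Bool) →
      ∀ b → H.Bounded η (λ w → InSlab (x ∸ η) (L + 2 * η) w × colour w ≡ b) (slabDiameter f L η)
    coloured = slab-two-colouring restrict f L η (coarse (tw (L + 2 * η) (x ∸ η)) _)

    wide : ∀ {v} a → a ≤ η → x ≤ layer v + a → layer v < x + L + a → InSlab (x ∸ η) (L + 2 * η) v
    wide {v} a a≤η lo hi =
      m≤n+o⇒m∸n≤o x η (≤-trans lo (≤-trans (+-monoʳ-≤ (layer v) a≤η) (≤-reflexive (+-comm (layer v) η)))) ,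
      <-≤-trans hi (≤-trans (+-mono-≤ (+-monoˡ-≤ L (m≤n+m∸n x η)) a≤η) (≤-reflexive (eq η (x ∸ η) L)))
      where
      eq : ∀ η y L → η + y + L + η ≡ y + (L + 2 * η)
      eq = solve-∀

    -- `a` counts the edges already walked, which bounds the drift out of the original slab.
    restrict-walk : ∀ {u v l} a → a + l ≤ η → x ≤ layer u + a → layer u < x + L + a →
                    Walk G u v l → Walk restrict u v l
    restrict-walk a le lo hi here = here
    restrict-walk {u} {l = suc l} a le lo hi (step {w = w} e p) =
      step (restrict-edge⁺ e (wide a (m+n≤o⇒m≤o a le) lo hi) (wide (suc a) (m+n≤o⇒m≤o (suc a) le′) lo′ hi′))
           (restrict-walk (suc a) le′ lo′ hi′ p)
      where
      le′ : suc a + l ≤ η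
      le′ = ≤-trans (≤-reflexive (≡.sym (+-suc a l))) le
      lo′ : x ≤ layer w + suc a
      lo′ = ≤-trans lo (≤-trans (+-monoˡ-≤ a (proj₁ (layering u w e))) (≤-reflexive (≡.sym (+-suc (layer w) a))))
      hi′ : layer w < x + L + suc a
      hi′ = ≤-trans (s≤s (proj₂ (layering u w e))) (≤-trans (s≤s hi) (≤-reflexive (≡.sym (+-suc (x + L) a))))

    restrict-dist⁺ : ∀ {u v} → InSlab x L u → DistLe G u v η → DistLe restrict u v η
    restrict-dist⁺ (lo , hi) (l , l≤η , p) =
      l , l≤η , restrict-walk 0 l≤η (≤-trans lo (m≤m+n _ 0)) (≤-trans hi (m≤m+n _ 0)) p

    chain : ∀ {u v b} → Chain η (λ w → InSlab x L w × proj₁ coloured w ≡ b) u v →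
            H.Chain η (λ w → InSlab (x ∸ η) (L + 2 * η) w × proj₁ coloured w ≡ b) u v
    chain [ (lo , hi) , eq ] =
      H.[ wide 0 z≤n (≤-trans lo (m≤m+n _ 0)) (≤-trans hi (m≤m+n _ 0)) , eq ]
    chain (cons (sl@(lo , hi) , eq) d c) =
      H.cons (wide 0 z≤n (≤-trans lo (m≤m+n _ 0)) (≤-trans hi (m≤m+n _ 0)) , eq) (restrict-dist⁺ sl d) (chain c)

-- Three colours on the slabs, modulo 3.

odd : ℕ → Bool
odd zero    = false
odd (suc i) = not (odd i)

rotate : Fin 3 → Fin 3
rotate zero             = suc zero
rotate (suc zero)       = suc (suc zero)
rotate (suc (suc zero)) = zero

residue : ℕ → Fin 3
residue zero    = zero
residue (suc i) = rotate (residue i)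

palette : Fin 3 → Bool → Fin 3
palette r true  = rotate r
palette r false = rotate (rotate r)

-- A colour is used in two consecutive slabs, then skips one; block i b is the upper slab of the pair.
block : ℕ → Bool → ℕ
block i true  = i
block i false = suc i

block-same : ∀ i b b′ → palette (residue i) b ≡ palette (residue i) b′ → block i b ≡ block i b′
block-same i b b′ eq = cong (block i) (injective (residue i) b b′ eq)
  where
  injective : ∀ r b b′ → palette r b ≡ palette r b′ → b ≡ b′
  injective r                true  true  _ = refl
  injective r                false false _ = refl
  injective zero             true  false ()
  injective (suc zero)       true  false ()
  injective (suc (suc zero)) true  false ()
  injective zero             false true  ()
  injective (suc zero)       false true  ()
  injective (suc (suc zero)) false true  ()

-- The palettes of consecutive slabs share one colour, `false` below and `true` above.
block-next : ∀ i b b′ → palette (residue i) b ≡ palette (residue (suc i)) b′ → block i b ≡ block (suc i) b′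
block-next i b b′ eq = go (residue i) b b′ eq
  where
  go : ∀ r b b′ → palette r b ≡ palette (rotate r) b′ → block i b ≡ block (suc i) b′
  go r                false true  _ = refl
  go zero             true  true  ()
  go (suc zero)       true  true  ()
  go (suc (suc zero)) true  true  ()
  go zero             true  false ()
  go (suc zero)       true  false ()
  go (suc (suc zero)) true  false ()
  go zero             false false ()
  go (suc zero)       false false ()
  go (suc (suc zero)) false false ()

block-close : ∀ {i j} b b′ → i ≤ suc j → j ≤ suc i →
              palette (residue i) b ≡ palette (residue j) b′ → block i b ≡ block j b′
block-close {i} {j} b b′ i≤1+j j≤1+i eq with <-cmp i j
... | tri≈ _ refl _ = block-same i b b′ eq
... | tri< i<j _ _ with refl ← ≤-antisym j≤1+i i<j = block-next i b b′ eq
... | tri> _ _ j<i with refl ← ≤-antisym i≤1+j j<i = ≡.sym (block-next j b′ b (≡.sym eq))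

module Scales (f : ℕ → ℕ) (δ : ℕ) where

  scale : Bool → ℕ
  scale false = δ
  -- The jump scale of `absorb` when the runs in an even slab, of diameter `bound false`, are
  -- skipped.
  scale true  = slabDiameter f (suc δ) δ + 2 * δ

  bound : Bool → ℕ
  bound β = slabDiameter f (suc δ) (scale β)

control : (ℕ → ℕ) → ℕ → ℕ
control f δ = bound true + 2 * (bound false + δ)
  where open Scales f δ

-- Assembling the slab colourings.

module _ (G : Graph) (layer : V G → ℕ) (layering : IsLayering G layer) (f : ℕ → ℕ)
         (tw : ∀ ℓ i → TreewidthLe G (λ v → i ≤ layer v × layer v < i + ℓ) (f ℓ)) (δ : ℕ) where
  open Metric G
  open Scales f δ

  L : ℕ
  -- Thick enough that a step of length δ gets no further than a neighbouring slab.
  L = suc δ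

  slab : V G → ℕ
  slab v = layer v / L

  layer<slab-end : ∀ v → layer v < suc (slab v) * L
  layer<slab-end v = ≤-<-trans (≤-reflexive (m≡m%n+[m/n]*n (layer v) L)) (+-monoˡ-< (slab v * L) (m%n<n (layer v) L))

  slab-InSlab : ∀ {v i} → slab v ≡ i → InSlab G layer layering (i * L) L v
  slab-InSlab {v} refl = m/n*n≤m (layer v) L , ≤-trans (layer<slab-end v) (≤-reflexive (+-comm L _))

  slab-close : ∀ {u v} → DistLe G u v δ → slab v ≤ suc (slab u)
  slab-close {u} {v} d = s≤s⁻¹ (m<n*o⇒m/o<n (<-≤-trans
    (s≤s (≤-trans (layer-dist G layer layering d) (+-monoˡ-≤ δ (<⇒≤ (layer<slab-end u)))))
    (≤-reflexive (≡.trans (≡.sym (+-suc (suc (slab u) * L) δ)) (+-comm (suc (slab u) * L) L)))))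

  coloured : ∀ i → ∃ λ (colour : V G → Bool) →
    ∀ b → Bounded (scale (odd i)) (λ w → InSlab G layer layering (i * L) L w × colour w ≡ b) (bound (odd i))
  coloured i = slab-colouring G layer layering f (i * L) L (scale (odd i)) tw

  shade : V G → Bool
  shade v = proj₁ (coloured (slab v)) v

  slab-bounded : ∀ i b {β} → odd i ≡ β → Bounded (scale β) (λ w → slab w ≡ i × shade w ≡ b) (bound β)
  slab-bounded i b refl c = proj₂ (coloured i) b
    (chain-map ≤-refl (λ { {w} (refl , eq) → slab-InSlab {w} refl , eq }) c)

  colour : V G → Fin 3
  colour v = palette (residue (slab v)) (shade v)

  blockOf : V G → ℕ
  blockOf v = block (slab v) (shade v)

  Upper Lower : ℕ → V G → Set
  Upper a w = slab w ≡ a × shade w ≡ true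
  Lower a w = suc (slab w) ≡ a × shade w ≡ false

  upper-or-lower : ∀ {w a} → blockOf w ≡ a → Upper a w ⊎ Lower a w
  upper-or-lower {w} eq with shade w
  ... | true  = inj₁ (eq , refl)
  ... | false = inj₂ (eq , refl)

  lower-bounded : ∀ a {β} → odd a ≡ not β → Bounded (scale β) (Lower a) (bound β)
  lower-bounded zero    _  c with () ← proj₁ (chain-head c)
  lower-bounded (suc i) eq c = slab-bounded i false (Bool.not-injective eq)
    (chain-map ≤-refl (λ { (e , s) → suc-injective e , s }) c)

  -- One slab of the pair is even and one odd. Runs in the even slab are absorbed into the odd one,
  -- which was coloured at the larger scale.
  block-bounded : ∀ a → Bounded δ (λ w → blockOf w ≡ a) (control f δ)
  block-bounded a c with odd a in eq
  ... | true  = absorb {P = Upper a} upper-or-lower (lower-bounded a eq) (slab-bounded a true eq) c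
  ... | false = absorb {P = Lower a} (Sum.swap ∘ upper-or-lower) (slab-bounded a true eq) (lower-bounded a eq) c

  colour-bounded : ∀ κ → Bounded δ (λ w → colour w ≡ κ) (control f δ)
  colour-bounded κ c = block-bounded _ (chain-map ≤-refl proj₂ (chain-invariant blockOf
    (λ { {x} {y} ex ey d → block-close (shade x) (shade y) (slab-close (dist-sym d)) (slab-close d)
                             (≡.trans ex (≡.sym ey)) }) c))

theorem19 : (𝒢 : GraphClass) → BoundedBakerTreewidth 𝒢 → AsdimLe 𝒢 2
theorem19 𝒢 (f , layered) = 2 , ≤-refl , control f , λ G G∈𝒢 δ →
  let layer , layering , tw = layered G G∈𝒢 in
  controlledPartition G (colour G layer layering f tw δ) (colour-bounded G layer layering f tw δ)
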